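{- Let $0\le \epsilon\le 0.3$. If a lazy algorithm assigns all the jobs $1,\dots,N$ to $m$ machines, with $S_i$ the set of jobs assigned to machine $i$, such that $\mathrm{Cost}(S_i)\ge 1-\epsilon$ for every $1\le i\le m$, then $$m\le \Big(\frac43+3\epsilon\Big)\mathrm{OPT},$$ where $\mathrm{OPT}$ is the minimum number of machines needed to serve all the jobs.
   Context: Submodular bin packing, normalized so that the machine capacity and the risk coefficient both equal $1$: each job $j\in\{1,\dots,N\}$ has parameters $\mu_j\ge0$ and $b_j\ge0$. For a set $S$ of jobs, $$\mathrm{Cost}(S)=\sum_{j\in S}\mu_j+\sqrt{\sum_{j\in S}b_j}.$$ A set $S$ is feasible (can be assigned to one machine) if $\mathrm{Cost}(S)\le 1$; every single job is assumed feasible. Every job must be assigned to exactly one machine and the set of jobs on each machine must be feasible; $\mathrm{OPT}$ is the minimum number of machines in such an assignment. Jobs arrive online one at a time, are assigned irrevocably upon arrival, and are never removed. An online algorithm is lazy if it purchases a new machine if and only if none of the already purchased machines can accommodate the newly arrived job (i.e., adding the job would make each existing machine's set infeasible); otherwise it assigns the job to one of the existing machines without violating the capacity constraint. -}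

module Defs where

open import Algebra.Apartness.Bundles using (HeytingField; HeytingCommutativeRing)
open import Algebra.Bundles using (CommutativeRing)
open import Data.Bool.Base using (if_then_else_)
open import Data.Fin.Base using (Fin)
open import Data.Fin.Subset using (Subset; _∈_; _∪_; ⁅_⁆)
open import Data.List.Base using (List; []; _∷_; allFin)
open import Data.Nat.Base as ℕ using (ℕ; zero; suc; NonZero)
open import Data.Product using (∃; ∃!; _×_; _,_; proj₁; proj₂)
open import Data.Sum.Base using (_⊎_; inj₁; inj₂)
open import Data.Vec.Base using (Vec; []; lookup; _[_]%=_; _∷ʳ_)
open import Level using (_⊔_) renaming (suc to lsuc)
open import Relation.Binary.Core using (Rel)
open import Relation.Binary.PropositionalEquality.Core using (_≡_)
open import Relation.Binary.Structures using (IsStrictPartialOrder)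
open import Relation.Nullary.Negation using (¬_)
import Algebra.Apartness.Properties.HeytingCommutativeRing as HeytingProperties
import Algebra.Properties.Ring as RingProperties
import Algebra.Properties.Semiring.Mult as Multiples
import Algebra.Properties.Monoid.Sum as Sums

record OrderedField c ℓ₁ ℓ₂ ℓ₃ : Set (lsuc (c ⊔ ℓ₁ ⊔ ℓ₂ ⊔ ℓ₃)) where
  infix 4 _<_ _≤_
  infixl 7 _/_

  field
    heytingField : HeytingField c ℓ₁ ℓ₂

  open HeytingField heytingField public

  field
    _<_                  : Rel Carrier ℓ₃
    isStrictPartialOrder : IsStrictPartialOrder _≈_ _<_
    <⇒#                  : ∀ {x y} → x < y → x # y
    #⇒<                  : ∀ {x y} → x # y → x < y ⊎ y < x
    +-monoˡ-<            : ∀ {x y} z → x < y → x + z < y + z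
    *-pos                : ∀ {x y} → 0# < x → 0# < y → 0# < x * y

  open HeytingCommutativeRing heytingCommutativeRing public using (commutativeRing)
  open CommutativeRing commutativeRing public using (ring; semiring; +-monoid)
  open HeytingProperties heytingCommutativeRing using (1#0; x-0≈x)
  open IsStrictPartialOrder isStrictPartialOrder public
    using (<-respˡ-≈; <-respʳ-≈) renaming (trans to <-trans; irrefl to <-irrefl)

  _≤_ : Rel Carrier ℓ₃
  x ≤ y = ¬ (y < x)

  fromℕ : ℕ → Carrier
  fromℕ n = n · 1#
    where open Multiples semiring using () renaming (_×_ to _·_)

  0<1 : 0# < 1#
  0<1 with #⇒< 1#0
  ... | inj₂ 0<1 = 0<1
  ... | inj₁ 1<0 = <-respʳ-≈ [-1]*[-1]≈1 (*-pos 0<-1 0<-1)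
    where
    open RingProperties ring using (-1*x≈-x; -‿involutive)
    0<-1 : 0# < - 1#
    0<-1 = <-respˡ-≈ (-‿inverseʳ 1#) (<-respʳ-≈ (+-identityˡ (- 1#)) (+-monoˡ-< (- 1#) 1<0))
    [-1]*[-1]≈1 : - 1# * - 1# ≈ 1#
    [-1]*[-1]≈1 = trans (-1*x≈-x (- 1#)) (-‿involutive 1#)

  0<fromℕ-suc : ∀ n → 0# < fromℕ (suc n)
  0<fromℕ-suc zero    = <-respʳ-≈ (sym (+-identityʳ 1#)) 0<1
  0<fromℕ-suc (suc n) = <-trans (0<fromℕ-suc n)
    (<-respˡ-≈ (+-identityˡ (fromℕ (suc n))) (+-monoˡ-< (fromℕ (suc n)) 0<1))

  fromℕ#0 : ∀ n .{{_ : NonZero n}} → fromℕ n # 0#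
  fromℕ#0 (suc n) = #-sym (<⇒# (0<fromℕ-suc n))

  inverse : ∀ x → x # 0# → Carrier
  inverse x x#0 = proj₁ (#⇒invertible x#0)

  -- Not just a projection: #⇒invertible inverts x - 0# rather than x.
  *-inverseʳ : ∀ x (x#0 : x # 0#) → x * inverse x x#0 ≈ 1#
  *-inverseʳ x x#0 = trans (*-congʳ (sym (x-0≈x x))) (proj₂ (proj₂ (#⇒invertible x#0)))

  _/_ : (p q : ℕ) .{{_ : NonZero q}} → Carrier
  p / q = fromℕ p * inverse (fromℕ q) (fromℕ#0 q)

-- The real numbers as a Cauchy-complete Archimedean ordered field, which
-- classically determines them up to isomorphism.  Apartness and _<_ are
-- primitive and not assumed decidable, so that the constructive reals also
-- satisfy the axioms.

record RealNumbers c ℓ₁ ℓ₂ ℓ₃ : Set (lsuc (c ⊔ ℓ₁ ⊔ ℓ₂ ⊔ ℓ₃)) where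
  field
    orderedField : OrderedField c ℓ₁ ℓ₂ ℓ₃

  open OrderedField orderedField public

  -- As m and n are interchangeable, this bounds the absolute value of s m - s n.
  Cauchy : (ℕ → Carrier) → Set (c ⊔ ℓ₃)
  Cauchy s = ∀ δ → 0# < δ →
    ∃ λ M → ∀ m n → M ℕ.≤ m → M ℕ.≤ n → s m < s n + δ

  _ConvergesTo_ : (ℕ → Carrier) → Carrier → Set (c ⊔ ℓ₃)
  s ConvergesTo l = ∀ δ → 0# < δ →
    ∃ λ M → ∀ n → M ℕ.≤ n → (s n < l + δ) × (l < s n + δ)

  -- Square roots of nonnegative numbers exist by completeness and are unique;
  -- √ merely names them.  Its values at negative numbers are unspecified.
  field
    archimedean : ∀ x → ∃ λ n → x < fromℕ n
    complete    : ∀ s → Cauchy s → ∃ λ l → s ConvergesTo l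
    √           : Carrier → Carrier
    0≤√         : ∀ {x} → 0# ≤ x → 0# ≤ √ x
    √*√≈x       : ∀ {x} → 0# ≤ x → √ x * √ x ≈ x

module BinPacking {c ℓ₁ ℓ₂ ℓ₃} (ℝ : RealNumbers c ℓ₁ ℓ₂ ℓ₃) where

  open RealNumbers ℝ
  open Sums +-monoid using (sum)

  record Jobs (N : ℕ) : Set (c ⊔ ℓ₃) where
    field
      μ   : Fin N → Carrier
      b   : Fin N → Carrier
      0≤μ : ∀ j → 0# ≤ μ j
      0≤b : ∀ j → 0# ≤ b j

  ∑∈ : ∀ {N} → Subset N → (Fin N → Carrier) → Carrier
  ∑∈ S f = sum λ j → if lookup S j then f j else 0#

  module _ {N : ℕ} (J : Jobs N) where

    open Jobs J

    Cost : Subset N → Carrier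
    Cost S = ∑∈ S μ + √ (∑∈ S b)

    Feasible : Subset N → Set ℓ₃
    Feasible S = Cost S ≤ 1#

    IsFeasibleAssignment : ∀ {k} → Vec (Subset N) k → Set ℓ₃
    IsFeasibleAssignment T =
      (∀ j → ∃! _≡_ λ i → j ∈ lookup T i) × (∀ i → Feasible (lookup T i))

    IsOPT : ℕ → Set ℓ₃
    IsOPT k = (∃ λ (T : Vec (Subset N) k) → IsFeasibleAssignment T)
            × (∀ k′ (T : Vec (Subset N) k′) → IsFeasibleAssignment T → k ℕ.≤ k′)

    -- S ⟶⟨ js ⟩ S′: starting from the purchased machines S, the jobs js arrive
    -- in this order, and some lazy choices lead to the machines S′.  When
    -- several machines can accommodate a job, any of them may be chosen.
    data _⟶⟨_⟩_ {m} (S : Vec (Subset N) m) : List (Fin N) → ∀ {m′} → Vec (Subset N) m′ → Set ℓ₃ where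
      done  : S ⟶⟨ [] ⟩ S
      place : ∀ {j js m′} {S′ : Vec (Subset N) m′} (i : Fin m) →
              Feasible (lookup S i ∪ ⁅ j ⁆) →
              (S [ i ]%= (_∪ ⁅ j ⁆)) ⟶⟨ js ⟩ S′ →
              S ⟶⟨ j ∷ js ⟩ S′
      buy   : ∀ {j js m′} {S′ : Vec (Subset N) m′} →
              (∀ i → ¬ Feasible (lookup S i ∪ ⁅ j ⁆)) →
              (S ∷ʳ ⁅ j ⁆) ⟶⟨ js ⟩ S′ →
              S ⟶⟨ j ∷ js ⟩ S′

    IsLazyOutcome : ∀ {m} → Vec (Subset N) m → Set ℓ₃
    IsLazyOutcome S = [] ⟶⟨ allFin N ⟩ S

{-# OPTIONS --safe #-}

-- Give job j the weight μ_j + b_j.  A set with √(∑ b) = s and cost at most 1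
-- has weight at most 1 - s + s², hence at most 1; a set with cost at least
-- 1 - ε has weight at least 1 - ε - s + s², hence at least 3/4 - ε.  Comparing
-- total weights gives m (3/4 - ε) ≤ OPT, and 1 ≤ (3/4 - ε) (4/3 + 3ε) for
-- 0 ≤ ε ≤ 3/10.  Of laziness, all that matters is that each job is placed once.
module Submission where

open import Algebra.Bundles using (CommutativeRing; CommutativeSemiring)
open import Data.Bool.Base using (true; false; if_then_else_)
open import Data.Bool.Properties using (∨-identityʳ)
open import Data.Fin.Base using (Fin; zero; suc)
open import Data.Fin.Subset using (Subset; _∈_; _∪_; ⁅_⁆; ⊥)
open import Data.Fin.Subset.Properties using (∪-identityˡ; ∪-identityʳ)
open import Data.List.Base as List using (List; []; _∷_)
open import Data.Nat.Base using (ℕ; zero; suc; NonZero)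
open import Data.Product using (∃; _×_; _,_; proj₁)
open import Data.Sum.Base using (_⊎_; inj₁; inj₂; [_,_]′)
open import Data.Vec.Base using (Vec; []; _∷_; lookup; _[_]%=_; _∷ʳ_)
open import Data.Vec.Properties using ([]=⇒lookup)
open import Defs
open import Function.Base using (_∘_)
open import Relation.Binary.Bundles using (Preorder)
open import Relation.Binary.PropositionalEquality.Core as ≡ using (_≡_)
open import Relation.Nullary.Negation using (¬_)
import Algebra.Properties.Semiring.Sum as SemiringSum
import Algebra.Solver.Ring.NaturalCoefficients.Default as SemiringSolver
import Relation.Binary.Reasoning.Preorder as PreorderReasoning

-- Order arithmetic in an ordered field, with no decision procedure for `_<_`.

module OrderedFieldProperties {c ℓ₁ ℓ₂ ℓ₃} (F : OrderedField c ℓ₁ ℓ₂ ℓ₃) where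

  open OrderedField F hiding (zero)
  open SemiringSum semiring using (sum)

  commutativeSemiring : CommutativeSemiring c ℓ₁
  commutativeSemiring = CommutativeRing.commutativeSemiring commutativeRing

  module Solver where
    open SemiringSolver commutativeSemiring public

    -- ⟦ numeral n ⟧ is fromℕ n definitionally; ⟦ con n ⟧ associates differently.
    numeral : ∀ {k} → ℕ → Polynomial k
    numeral zero    = con 0
    numeral (suc n) = con 1 :+ numeral n

  open Solver using (solve; _:=_; _:+_; _:*_; con; numeral)

  -- Inherited from cotransitivity of apartness: of the four resulting cases, two need transitivity
  -- through the other endpoint. It stands in for trichotomy.
  <-cotrans : ∀ {x y} → x < y → ∀ z → x < z ⊎ z < y
  <-cotrans x<y z with #-cotrans (<⇒# x<y) z
  ... | inj₁ x#z with #⇒< x#z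
  ...   | inj₁ x<z = inj₁ x<z
  ...   | inj₂ z<x = inj₂ (<-trans z<x x<y)
  <-cotrans x<y z | inj₂ z#y with #⇒< z#y
  ...   | inj₁ z<y = inj₂ z<y
  ...   | inj₂ y<z = inj₁ (<-trans x<y y<z)

  ≤-reflexive : ∀ {x y} → x ≈ y → x ≤ y
  ≤-reflexive x≈y y<x = <-irrefl (sym x≈y) y<x

  ≤-trans : ∀ {x y z} → x ≤ y → y ≤ z → x ≤ z
  ≤-trans {y = y} x≤y y≤z z<x with <-cotrans z<x y
  ... | inj₁ z<y = y≤z z<y
  ... | inj₂ y<x = x≤y y<x

  -- Apartness is tight, and either way of being apart contradicts a hypothesis.
  ≤-antisym : ∀ {x y} → x ≤ y → y ≤ x → x ≈ y
  ≤-antisym {x} {y} x≤y y≤x = proj₁ (tight x y) ([ y≤x , x≤y ]′ ∘ #⇒<)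

  ≤-preorder : Preorder c ℓ₁ ℓ₃
  ≤-preorder = record
    { isPreorder = record
      { isEquivalence = isEquivalence
      ; reflexive     = ≤-reflexive
      ; trans         = ≤-trans
      }
    }

  <⇒≤ : ∀ {x y} → x < y → x ≤ y
  <⇒≤ x<y y<x = <-irrefl refl (<-trans x<y y<x)

  open PreorderReasoning ≤-preorder

  +-cancelʳ-≤ : ∀ {x y} z → x + z ≤ y + z → x ≤ y
  +-cancelʳ-≤ z x+z≤y+z y<x = x+z≤y+z (+-monoˡ-< z y<x)

  [x+z]-z≈x : ∀ x z → (x + z) - z ≈ x
  [x+z]-z≈x x z = trans (+-assoc x z (- z)) (trans (+-congˡ (-‿inverseʳ z)) (+-identityʳ x))

  +-monoˡ-≤ : ∀ {x y} z → x ≤ y → x + z ≤ y + z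
  +-monoˡ-≤ {x} {y} z x≤y y+z<x+z =
    x≤y (<-respˡ-≈ ([x+z]-z≈x y z) (<-respʳ-≈ ([x+z]-z≈x x z) (+-monoˡ-< (- z) y+z<x+z)))

  +-monoʳ-≤ : ∀ {x y} z → x ≤ y → z + x ≤ z + y
  +-monoʳ-≤ {x} {y} z x≤y = begin
    z + x ≈⟨ +-comm z x ⟩
    x + z ≲⟨ +-monoˡ-≤ z x≤y ⟩
    y + z ≈⟨ +-comm y z ⟩
    z + y ∎

  +-mono-≤ : ∀ {x y u v} → x ≤ y → u ≤ v → x + u ≤ y + v
  +-mono-≤ {y = y} {u} x≤y u≤v = ≤-trans (+-monoˡ-≤ u x≤y) (+-monoʳ-≤ y u≤v)

  x≤x+y : ∀ {x y} → 0# ≤ y → x ≤ x + y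
  x≤x+y {x} 0≤y = ≤-trans (≤-reflexive (sym (+-identityʳ x))) (+-monoʳ-≤ x 0≤y)

  y≤x+y : ∀ {x y} → 0# ≤ x → y ≤ x + y
  y≤x+y {x} {y} 0≤x = ≤-trans (≤-reflexive (sym (+-identityˡ y))) (+-monoˡ-≤ y 0≤x)

  +-nonneg : ∀ {x y} → 0# ≤ x → 0# ≤ y → 0# ≤ x + y
  +-nonneg 0≤x 0≤y = ≤-trans 0≤x (x≤x+y 0≤y)

  x+[y-x]≈y : ∀ x y → x + (y - x) ≈ y
  x+[y-x]≈y x y = trans (+-comm x (y - x))
    (trans (+-assoc y (- x) x) (trans (+-congˡ (-‿inverseˡ x)) (+-identityʳ y)))

  -- Turns an inequality into an equation with a nonnegative slack, so that the semiring solver,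
  -- which knows no subtraction, can do the algebra.
  ≤⇒∃ : ∀ {x y} → x ≤ y → ∃ λ d → 0# ≤ d × x + d ≈ y
  ≤⇒∃ {x} {y} x≤y = y - x
    , ≤-trans (≤-reflexive (sym (-‿inverseʳ x))) (+-monoˡ-≤ (- x) x≤y)
    , x+[y-x]≈y x y

  -- The goal is a negation, so both factors may be assumed positive: a factor that is not positive
  -- equals `0#`, and then the product vanishes.
  *-nonneg : ∀ {x y} → 0# ≤ x → 0# ≤ y → 0# ≤ x * y
  *-nonneg {x} {y} 0≤x 0≤y xy<0 = 0≮x λ 0<x → 0≮y λ 0<y → <⇒≤ (*-pos 0<x 0<y) xy<0
    where
    0≮x : ¬ ¬ 0# < x
    0≮x x≤0 = ≤-reflexive (sym (trans (*-congʳ (≤-antisym x≤0 0≤x)) (zeroˡ y))) xy<0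
    0≮y : ¬ ¬ 0# < y
    0≮y y≤0 = ≤-reflexive (sym (trans (*-congˡ (≤-antisym y≤0 0≤y)) (zeroʳ x))) xy<0

  *-monoʳ-≤ : ∀ {x y z} → 0# ≤ z → x ≤ y → z * x ≤ z * y
  *-monoʳ-≤ {x} {y} {z} 0≤z x≤y with d , 0≤d , x+d≈y ← ≤⇒∃ x≤y = begin
    z * x         ≲⟨ x≤x+y (*-nonneg 0≤z 0≤d) ⟩
    z * x + z * d ≈⟨ distribˡ z x d ⟨
    z * (x + d)   ≈⟨ *-congˡ x+d≈y ⟩
    z * y         ∎

  *-monoˡ-≤ : ∀ {x y z} → 0# ≤ z → x ≤ y → x * z ≤ y * z
  *-monoˡ-≤ {x} {y} {z} 0≤z x≤y = begin
    x * z ≈⟨ *-comm x z ⟩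
    z * x ≲⟨ *-monoʳ-≤ 0≤z x≤y ⟩
    z * y ≈⟨ *-comm z y ⟩
    y * z ∎

  *-cancelˡ-≤ : ∀ {x y z} → 0# < z → z * x ≤ z * y → x ≤ y
  *-cancelˡ-≤ {x} {y} {z} 0<z zx≤zy y<x = zx≤zy
    (<-respˡ-≈ (+-identityˡ (z * y))
    (<-respʳ-≈ (trans (sym (distribˡ z (x - y) y)) (*-congˡ (trans (+-comm (x - y) y) (x+[y-x]≈y y x))))
    (+-monoˡ-< (z * y) (*-pos 0<z 0<x-y))))
    where
    0<x-y : 0# < x - y
    0<x-y = <-respˡ-≈ (-‿inverseʳ y) (+-monoˡ-< (- y) y<x)

  fromℕ-nonneg : ∀ n → 0# ≤ fromℕ n
  fromℕ-nonneg zero    = ≤-reflexive refl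
  fromℕ-nonneg (suc n) = <⇒≤ (0<fromℕ-suc n)

  /-*-cancel : ∀ p q .{{_ : NonZero q}} → fromℕ q * (p / q) ≈ fromℕ p
  /-*-cancel p q = trans
    (solve 3 (λ q p i → q :* (p :* i) := p :* (q :* i)) refl (fromℕ q) (fromℕ p) _)
    (trans (*-congˡ (*-inverseʳ (fromℕ q) (fromℕ#0 q))) (*-identityʳ (fromℕ p)))

  -- Suffices for case distinctions when the goal is an inequality `_≤_`, itself a negation.
  ≤-total-¬¬ : ∀ x y → ¬ ¬ (x ≤ y ⊎ y ≤ x)
  ≤-total-¬¬ x y ¬total = ¬total (inj₁ λ y<x → ¬total (inj₂ (<⇒≤ y<x)))

  -- This is 0 ≤ (y - x)² without subtraction: if `x ≤ y` and y = x + d, the two sides differ by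
  -- `d * d`. The other case follows by symmetry.
  x*y+x*y≤x*x+y*y : ∀ x y → x * y + x * y ≤ x * x + y * y
  x*y+x*y≤x*x+y*y x y xx+yy<xy+xy = ≤-total-¬¬ x y λ where
      (inj₁ x≤y) → ordered x≤y xx+yy<xy+xy
      (inj₂ y≤x) → ordered y≤x
        (<-respˡ-≈ (+-comm _ _) (<-respʳ-≈ (+-cong (*-comm x y) (*-comm x y)) xx+yy<xy+xy))
    where
    ordered : ∀ {x y} → x ≤ y → x * y + x * y ≤ x * x + y * y
    ordered {x} {y} x≤y with d , 0≤d , x+d≈y ← ≤⇒∃ x≤y = begin
      x * y + x * y                     ≈⟨ +-cong (*-congˡ x+d≈y) (*-congˡ x+d≈y) ⟨
      x * (x + d) + x * (x + d)         ≲⟨ x≤x+y (*-nonneg 0≤d 0≤d) ⟩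
      x * (x + d) + x * (x + d) + d * d
        ≈⟨ solve 2 (λ x d → x :* (x :+ d) :+ x :* (x :+ d) :+ d :* d
                         := x :* x :+ (x :+ d) :* (x :+ d)) refl x d ⟩
      x * x + (x + d) * (x + d)         ≈⟨ +-congˡ (*-cong x+d≈y x+d≈y) ⟩
      x * x + y * y                     ∎

  -- Finite sums and the order.

  sum-mono-≤ : ∀ {n} {f g : Fin n → Carrier} → (∀ i → f i ≤ g i) → sum f ≤ sum g
  sum-mono-≤ {zero}  f≤g = ≤-reflexive refl
  sum-mono-≤ {suc n} f≤g = +-mono-≤ (f≤g zero) (sum-mono-≤ (f≤g ∘ suc))

  sum-nonneg : ∀ {n} {f : Fin n → Carrier} → (∀ i → 0# ≤ f i) → 0# ≤ sum f
  sum-nonneg {zero}  0≤f = ≤-reflexive refl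
  sum-nonneg {suc n} 0≤f = +-nonneg (0≤f zero) (sum-nonneg (0≤f ∘ suc))

  f≤sum : ∀ {n} {f : Fin n → Carrier} → (∀ i → 0# ≤ f i) → ∀ i → f i ≤ sum f
  f≤sum 0≤f zero    = x≤x+y (sum-nonneg (0≤f ∘ suc))
  f≤sum 0≤f (suc i) = ≤-trans (f≤sum (0≤f ∘ suc) i) (y≤x+y (0≤f zero))

  sum-const : ∀ n x → sum {n} (λ _ → x) ≈ fromℕ n * x
  sum-const zero    x = sym (zeroˡ x)
  sum-const (suc n) x = trans (+-cong (sym (*-identityˡ x)) (sum-const n x))
                              (sym (distribʳ x 1# (fromℕ n)))

  -- The numerical estimates behind 4/3 + 3ε.

  -- ε ≤ 3 / 10 enters through 3 ≈ 10 (ε + δ) with 0# ≤ δ, which makes all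
  -- the polynomial identities homogeneous in ε and δ: below, 6 ε + 10 δ is
  -- 3 - 4 ε and 67 ε + 40 δ is 12 + 27 ε = 9 (4 / 3 + 3 ε).
  module Slack {ε δ : Carrier} (0≤ε : 0# ≤ ε) (0≤δ : 0# ≤ δ) (ε+δ≈3/10 : ε + δ ≈ 3 / 10) where

    3≈10[ε+δ] : fromℕ 3 ≈ fromℕ 10 * (ε + δ)
    3≈10[ε+δ] = trans (sym (/-*-cancel 3 10)) (*-congˡ (sym ε+δ≈3/10))

    3-4ε 12+27ε : Carrier
    3-4ε   = fromℕ 6 * ε + fromℕ 10 * δ
    12+27ε = fromℕ 67 * ε + fromℕ 40 * δ

    12+27ε-nonneg : 0# ≤ 12+27ε
    12+27ε-nonneg = +-nonneg (*-nonneg (fromℕ-nonneg 67) 0≤ε) (*-nonneg (fromℕ-nonneg 40) 0≤δ)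

    3-4ε+4ε≈3 : 3-4ε + fromℕ 4 * ε ≈ fromℕ 3
    3-4ε+4ε≈3 = trans
      (solve 2 (λ ε δ → numeral 6 :* ε :+ numeral 10 :* δ :+ numeral 4 :* ε
                     := numeral 10 :* (ε :+ δ)) refl ε δ)
      (sym 3≈10[ε+δ])

    12+27ε≈9[4/3+3ε] : 12+27ε ≈ fromℕ 9 * (4 / 3 + fromℕ 3 * ε)
    12+27ε≈9[4/3+3ε] = trans
      (solve 2 (λ ε δ → numeral 67 :* ε :+ numeral 40 :* δ
                     := numeral 4 :* (numeral 10 :* (ε :+ δ)) :+ numeral 27 :* ε) refl ε δ)
      (trans (+-congʳ (*-congˡ (sym 3≈10[ε+δ])))
      (trans
      -- The factors of 12 trade places so that 4, rather than 3, can be rewritten, as 3 times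
      -- `4 / 3`.
      (solve 1 (λ ε → numeral 4 :* numeral 3 :+ numeral 27 :* ε
                   := numeral 3 :* numeral 4 :+ numeral 27 :* ε) refl ε)
      (trans (+-congʳ (*-congˡ (sym (/-*-cancel 4 3))))
      (solve 2 (λ ε x → numeral 3 :* (numeral 3 :* x) :+ numeral 27 :* ε
                     := numeral 9 :* (x :+ numeral 3 :* ε)) refl ε (4 / 3)))))

    -- Subtracting 36 leaves ε (33 - 108 ε), nonnegative for 0 ≤ ε ≤ 11/36, a range that contains
    -- 3/10. In terms of `ε` and `δ` this excess is ε (2 ε + 110 δ), visibly nonnegative.
    36≤[3-4ε][12+27ε] : fromℕ 36 ≤ 3-4ε * 12+27ε
    36≤[3-4ε][12+27ε] = begin
      fromℕ 36                        ≈⟨ solve 0 (numeral 36 := numeral 4 :* (numeral 3 :* numeral 3)) refl ⟩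
      fromℕ 4 * (fromℕ 3 * fromℕ 3)   ≈⟨ *-congˡ (*-cong 3≈10[ε+δ] 3≈10[ε+δ]) ⟩
      fromℕ 4 * (T * T)               ≲⟨ x≤x+y (*-nonneg 0≤ε (+-nonneg (*-nonneg (fromℕ-nonneg 2) 0≤ε)
                                                                       (*-nonneg (fromℕ-nonneg 110) 0≤δ))) ⟩
      fromℕ 4 * (T * T) + ε * (fromℕ 2 * ε + fromℕ 110 * δ)
        ≈⟨ solve 2 (λ ε δ → numeral 4 :* (numeral 10 :* (ε :+ δ) :* (numeral 10 :* (ε :+ δ)))
                         :+ ε :* (numeral 2 :* ε :+ numeral 110 :* δ)
                         := (numeral 6 :* ε :+ numeral 10 :* δ) :* (numeral 67 :* ε :+ numeral 40 :* δ))
             refl ε δ ⟩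
      3-4ε * 12+27ε                   ∎
      where T = fromℕ 10 * (ε + δ)

    -- Rests on 4 (s² - s) + 1 = (2 s - 1)² ≥ 0. Adding 4 ε + 4 s + 1 to both sides removes all
    -- subtraction.
    almost-full⇒heavy : ∀ {M s} → 1# - ε ≤ M + s → 3-4ε ≤ fromℕ 4 * (M + s * s)
    almost-full⇒heavy {M} {s} 1-ε≤M+s = +-cancelʳ-≤ (fromℕ 4 * ε + (fromℕ 4 * s + 1#)) (begin
      3-4ε + (fromℕ 4 * ε + (fromℕ 4 * s + 1#)) ≈⟨ +-assoc _ _ _ ⟨
      3-4ε + fromℕ 4 * ε + (fromℕ 4 * s + 1#)   ≈⟨ +-congʳ 3-4ε+4ε≈3 ⟩
      fromℕ 3 + (fromℕ 4 * s + 1#)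
        ≈⟨ solve 1 (λ s → numeral 3 :+ (numeral 4 :* s :+ con 1)
                       := numeral 4 :* con 1 :+ (numeral 2 :* s :* con 1 :+ numeral 2 :* s :* con 1)) refl s ⟩
      fromℕ 4 * 1# + (fromℕ 2 * s * 1# + fromℕ 2 * s * 1#)
        -- Four times the hypothesis, plus the square inequality for 2 s and 1, that is, 4 s ≤ 4 s²
        -- + 1.
        ≲⟨ +-mono-≤ (*-monoʳ-≤ (fromℕ-nonneg 4) 1≤M+s+ε) (x*y+x*y≤x*x+y*y (fromℕ 2 * s) 1#) ⟩
      fromℕ 4 * (M + s + ε) + (fromℕ 2 * s * (fromℕ 2 * s) + 1# * 1#)
        ≈⟨ solve 3 (λ M s ε → numeral 4 :* (M :+ s :+ ε)
                           :+ (numeral 2 :* s :* (numeral 2 :* s) :+ con 1 :* con 1)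
                           := numeral 4 :* (M :+ s :* s) :+ (numeral 4 :* ε :+ (numeral 4 :* s :+ con 1)))
             refl M s ε ⟩
      fromℕ 4 * (M + s * s) + (fromℕ 4 * ε + (fromℕ 4 * s + 1#)) ∎)
      where
      1≤M+s+ε : 1# ≤ M + s + ε
      1≤M+s+ε = ≤-trans
        (≤-reflexive (sym (trans (+-comm (1# - ε) ε) (x+[y-x]≈y ε 1#))))
        (+-monoˡ-≤ ε 1-ε≤M+s)

    bin-count : ∀ {m k W} → fromℕ m * 3-4ε ≤ fromℕ 4 * W → W ≤ fromℕ k →
                fromℕ m ≤ (4 / 3 + fromℕ 3 * ε) * fromℕ k
    -- The factor 36 is 4 times 9: the 4 comes from `fromℕ 4 * W`, the 9 from `12+27ε≈9[4/3+3ε]`.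
    bin-count {m} {k} {W} m[3-4ε]≤4W W≤k = *-cancelˡ-≤ (0<fromℕ-suc 35) (begin
      fromℕ 36 * fromℕ m           ≈⟨ *-comm _ _ ⟩
      fromℕ m * fromℕ 36           ≲⟨ *-monoʳ-≤ (fromℕ-nonneg m) 36≤[3-4ε][12+27ε] ⟩
      fromℕ m * (3-4ε * 12+27ε)    ≈⟨ *-assoc _ _ _ ⟨
      fromℕ m * 3-4ε * 12+27ε      ≲⟨ *-monoˡ-≤ 12+27ε-nonneg m[3-4ε]≤4W ⟩
      fromℕ 4 * W * 12+27ε         ≲⟨ *-monoˡ-≤ 12+27ε-nonneg (*-monoʳ-≤ (fromℕ-nonneg 4) W≤k) ⟩
      fromℕ 4 * fromℕ k * 12+27ε   ≈⟨ *-congˡ 12+27ε≈9[4/3+3ε] ⟩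
      fromℕ 4 * fromℕ k * (fromℕ 9 * α)
        ≈⟨ solve 2 (λ k α → numeral 4 :* k :* (numeral 9 :* α) := numeral 36 :* (α :* k)) refl (fromℕ k) α ⟩
      fromℕ 36 * (α * fromℕ k)     ∎)
      where α = 4 / 3 + fromℕ 3 * ε

  -- With 1 = M + s + d, the gap 1 - M - s² is s (1 - s) + d = s (M + d) + d, a sum of nonnegative
  -- terms.
  full⇒light : ∀ {M s} → 0# ≤ M → 0# ≤ s → M + s ≤ 1# → M + s * s ≤ 1#
  full⇒light {M} {s} 0≤M 0≤s M+s≤1 with d , 0≤d , M+s+d≈1 ← ≤⇒∃ M+s≤1 = begin
    M + s * s                       ≲⟨ x≤x+y (+-nonneg (*-nonneg 0≤s (+-nonneg 0≤M 0≤d)) 0≤d) ⟩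
    M + s * s + (s * (M + d) + d)
      ≈⟨ solve 3 (λ M s d → M :+ s :* s :+ (s :* (M :+ d) :+ d)
                         := M :+ s :* (M :+ s :+ d) :+ d) refl M s d ⟩
    M + s * (M + s + d) + d         ≈⟨ +-congʳ (+-congˡ (*-congˡ M+s+d≈1)) ⟩
    M + s * 1# + d                  ≈⟨ +-congʳ (+-congˡ (*-identityʳ s)) ⟩
    M + s + d                       ≈⟨ M+s+d≈1 ⟩
    1#                              ∎

-- Sums over sets of jobs and over machines.

module BinPackingProperties {c ℓ₁ ℓ₂ ℓ₃} (ℝ : RealNumbers c ℓ₁ ℓ₂ ℓ₃) where

  open RealNumbers ℝ hiding (zero)
  open BinPacking ℝ
  open OrderedFieldProperties orderedField
  open SemiringSum semiring using (sum; sum-cong-≋; ∑-comm; ∑-distrib-+; *-distribˡ-sum)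
  open PreorderReasoning ≤-preorder

  restrict : ∀ {N} → Subset N → (Fin N → Carrier) → Fin N → Carrier
  restrict S f j = if lookup S j then f j else 0#

  if-nonneg : ∀ x {y} → 0# ≤ y → 0# ≤ (if x then y else 0#)
  if-nonneg true  0≤y = 0≤y
  if-nonneg false 0≤y = ≤-reflexive refl

  ∑∈-nonneg : ∀ {N} (S : Subset N) {f} → (∀ j → 0# ≤ f j) → 0# ≤ ∑∈ S f
  ∑∈-nonneg S 0≤f = sum-nonneg λ j → if-nonneg (lookup S j) (0≤f j)

  ∑∈-distrib-+ : ∀ {N} (S : Subset N) f g → ∑∈ S (λ j → f j + g j) ≈ ∑∈ S f + ∑∈ S g
  ∑∈-distrib-+ S f g = trans
    (sum-cong-≋ λ j → if-distrib-+ (lookup S j))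
    (∑-distrib-+ (restrict S f) (restrict S g))
    where
    if-distrib-+ : ∀ x {u v} →
      (if x then u + v else 0#) ≈ (if x then u else 0#) + (if x then v else 0#)
    if-distrib-+ true  = refl
    if-distrib-+ false = sym (+-identityˡ 0#)

  ∑∈-⊥ : ∀ {N} f → ∑∈ {N} ⊥ f ≈ 0#
  ∑∈-⊥ {zero}  f = refl
  ∑∈-⊥ {suc N} f = trans (+-identityˡ _) (∑∈-⊥ (f ∘ suc))

  -- Strict inequality can occur only if `j` already lies in `S`, where the right side counts `f j`
  -- twice. An upper bound is what `total-run` needs.
  ∑∈-∪⁅⁆-≤ : ∀ {N} (S : Subset N) j {f} → (∀ j → 0# ≤ f j) →
             ∑∈ (S ∪ ⁅ j ⁆) f ≤ ∑∈ S f + f j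
  ∑∈-∪⁅⁆-≤ (true  ∷ S) zero 0≤f rewrite ∪-identityʳ S = x≤x+y (0≤f zero)
  ∑∈-∪⁅⁆-≤ (false ∷ S) zero 0≤f rewrite ∪-identityʳ S = ≤-reflexive
    (trans (+-comm _ _) (+-congʳ (sym (+-identityˡ _))))
  ∑∈-∪⁅⁆-≤ (x ∷ S) (suc j) 0≤f rewrite ∨-identityʳ x = ≤-trans
    (+-monoʳ-≤ _ (∑∈-∪⁅⁆-≤ S j (0≤f ∘ suc))) (≤-reflexive (sym (+-assoc _ _ _)))

  ∑∈-⁅⁆-≤ : ∀ {N} (j : Fin N) {f} → (∀ j → 0# ≤ f j) → ∑∈ ⁅ j ⁆ f ≤ f j
  ∑∈-⁅⁆-≤ j {f} 0≤f = begin
    ∑∈ ⁅ j ⁆ f       ≡⟨ ≡.cong (λ S → ∑∈ S f) (∪-identityˡ ⁅ j ⁆) ⟨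
    ∑∈ (⊥ ∪ ⁅ j ⁆) f ≲⟨ ∑∈-∪⁅⁆-≤ ⊥ j 0≤f ⟩
    ∑∈ ⊥ f + f j     ≈⟨ trans (+-congʳ (∑∈-⊥ f)) (+-identityˡ (f j)) ⟩
    f j              ∎

  total : ∀ {N k} → (Fin N → Carrier) → Vec (Subset N) k → Carrier
  total f T = sum λ i → ∑∈ (lookup T i) f

  sumList : ∀ {A : Set} → (A → Carrier) → List A → Carrier
  sumList f []       = 0#
  sumList f (x ∷ xs) = f x + sumList f xs

  sumList-tabulate : ∀ {A : Set} (f : A → Carrier) {n} (g : Fin n → A) →
                     sumList f (List.tabulate g) ≡ sum (f ∘ g)
  sumList-tabulate f {zero}  g = ≡.refl
  sumList-tabulate f {suc n} g = ≡.cong (f (g zero) +_) (sumList-tabulate f (g ∘ suc))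

  module _ {N} (f : Fin N → Carrier) (0≤f : ∀ j → 0# ≤ f j) where

    total-place : ∀ {k} (T : Vec (Subset N) k) i j →
                  total f (T [ i ]%= (_∪ ⁅ j ⁆)) ≤ total f T + f j
    total-place (S ∷ T) zero    j = begin
      ∑∈ (S ∪ ⁅ j ⁆) f + total f T ≲⟨ +-monoˡ-≤ (total f T) (∑∈-∪⁅⁆-≤ S j 0≤f) ⟩
      ∑∈ S f + f j + total f T     ≈⟨ +-assoc _ _ _ ⟩
      ∑∈ S f + (f j + total f T)   ≈⟨ +-congˡ (+-comm _ _) ⟩
      ∑∈ S f + (total f T + f j)   ≈⟨ +-assoc _ _ _ ⟨
      ∑∈ S f + total f T + f j     ∎
    total-place (S ∷ T) (suc i) j = ≤-trans
      (+-monoʳ-≤ (∑∈ S f) (total-place T i j)) (≤-reflexive (sym (+-assoc _ _ _)))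

    total-buy : ∀ {k} (T : Vec (Subset N) k) j → total f (T ∷ʳ ⁅ j ⁆) ≤ total f T + f j
    total-buy []      j = begin
      ∑∈ ⁅ j ⁆ f + 0# ≈⟨ +-comm _ _ ⟩
      0# + ∑∈ ⁅ j ⁆ f ≲⟨ +-monoʳ-≤ 0# (∑∈-⁅⁆-≤ j 0≤f) ⟩
      0# + f j        ∎
    total-buy (S ∷ T) j = ≤-trans
      (+-monoʳ-≤ (∑∈ S f) (total-buy T j)) (≤-reflexive (sym (+-assoc _ _ _)))

    -- Double counting: after exchanging the sums, job `j` contributes `f j` once per machine
    -- holding it, and at least one machine does.
    cover⇒sum≤total : ∀ {k} (T : Vec (Subset N) k) → (∀ j → ∃ λ i → j ∈ lookup T i) →
                      sum f ≤ total f T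
    cover⇒sum≤total T cover = begin
      sum f                                           ≲⟨ sum-mono-≤ f≤ ⟩
      sum (λ j → sum λ i → restrict (lookup T i) f j) ≈⟨ ∑-comm (λ i j → restrict (lookup T i) f j) ⟨
      total f T                                       ∎
      where
      f≤ : ∀ j → f j ≤ sum λ i → restrict (lookup T i) f j
      f≤ j with i , j∈Tᵢ ← cover j = ≤-trans
        -- Membership says that the lookup is `true`, so the conditional reduces to `f j`.
        (≤-reflexive (reflexive (≡.cong (λ x → if x then f j else 0#) (≡.sym ([]=⇒lookup j∈Tᵢ)))))
        (f≤sum (λ i → if-nonneg (lookup (lookup T i) j) (0≤f j)) i)

    -- Induction on the run: each arrival of `j`, placed or on a new machine, adds at most `f j`.
    -- The starting machines are arbitrary so that the induction applies after each arrival.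
    total-run : ∀ (J : Jobs N) {k k′ js} {T : Vec (Subset N) k} {T′ : Vec (Subset N) k′} →
                _⟶⟨_⟩_ J T js T′ → total f T′ ≤ total f T + sumList f js
    total-run J done = ≤-reflexive (sym (+-identityʳ _))
    total-run J {T = T} (place {j} i _ run) = ≤-trans (total-run J run) (≤-trans
      (+-monoˡ-≤ _ (total-place T i j)) (≤-reflexive (+-assoc _ _ _)))
    total-run J {T = T} (buy {j} _ run) = ≤-trans (total-run J run) (≤-trans
      (+-monoˡ-≤ _ (total-buy T j)) (≤-reflexive (+-assoc _ _ _)))

    total-lazy : ∀ (J : Jobs N) {k} {T : Vec (Subset N) k} → IsLazyOutcome J T → total f T ≤ sum f
    total-lazy J lazy = ≤-trans (total-run J lazy)
      -- The run starts with no machines, of total `0#`, and `allFin N` tabulates the identity.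
      (≤-reflexive (trans (+-identityˡ _) (reflexive (sumList-tabulate f (λ j → j)))))

  -- Job weights, bounded on both sides.

  module _ {N} (J : Jobs N) where

    open Jobs J

    weight : Fin N → Carrier
    weight j = μ j + b j

    weight-nonneg : ∀ j → 0# ≤ weight j
    weight-nonneg j = +-nonneg (0≤μ j) (0≤b j)

    -- Brings the weight into the form `M + s * s`, where `M + s` is the cost, as `full⇒light` and
    -- `almost-full⇒heavy` require.
    weight≈M+√B*√B : ∀ S → ∑∈ S weight ≈ ∑∈ S μ + √ (∑∈ S b) * √ (∑∈ S b)
    weight≈M+√B*√B S = trans (∑∈-distrib-+ S μ b) (+-congˡ (sym (√*√≈x (∑∈-nonneg S 0≤b))))

    feasible⇒weight≤1 : ∀ S → Feasible J S → ∑∈ S weight ≤ 1#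
    feasible⇒weight≤1 S feasible = ≤-trans (≤-reflexive (weight≈M+√B*√B S))
      (full⇒light (∑∈-nonneg S 0≤μ) (0≤√ (∑∈-nonneg S 0≤b)) feasible)

    total-weight≤opt : ∀ {k} (T : Vec (Subset N) k) → IsFeasibleAssignment J T →
                       sum weight ≤ fromℕ k
    total-weight≤opt {k} T (partition , feasible) = begin
      sum weight         ≲⟨ cover⇒sum≤total weight weight-nonneg T
                          (λ j → let i , j∈Tᵢ , _ = partition j in i , j∈Tᵢ) ⟩
      total weight T     ≲⟨ sum-mono-≤ (λ i → feasible⇒weight≤1 (lookup T i) (feasible i)) ⟩
      sum {k} (λ _ → 1#) ≈⟨ trans (sum-const k 1#) (*-identityʳ (fromℕ k)) ⟩
      fromℕ k            ∎

    -- The factor 4 clears the denominator of 3/4 - ε; `x` becomes `3-4ε`.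
    lazy-count : ∀ {x} {m} (S : Vec (Subset N) m) → IsLazyOutcome J S →
                 (∀ i → x ≤ fromℕ 4 * ∑∈ (lookup S i) weight) →
                 fromℕ m * x ≤ fromℕ 4 * sum weight
    lazy-count {x} {m} S lazy x≤ = begin
      fromℕ m * x                                      ≈⟨ sum-const m x ⟨
      sum {m} (λ _ → x)                                ≲⟨ sum-mono-≤ x≤ ⟩
      sum {m} (λ i → fromℕ 4 * ∑∈ (lookup S i) weight)
        ≈⟨ *-distribˡ-sum {m} (fromℕ 4) (λ i → ∑∈ (lookup S i) weight) ⟨
      fromℕ 4 * total weight S
        ≲⟨ *-monoʳ-≤ (fromℕ-nonneg 4) (total-lazy weight weight-nonneg J lazy) ⟩
      fromℕ 4 * sum weight                             ∎

theorem3 : ∀ {c ℓ₁ ℓ₂ ℓ₃} (ℝ : RealNumbers c ℓ₁ ℓ₂ ℓ₃) →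
    let open RealNumbers ℝ
        open BinPacking ℝ
    in
    ∀ (ε : Carrier) → 0# ≤ ε → ε ≤ 3 / 10 →
    ∀ {N : ℕ} (J : Jobs N) → (∀ j → Feasible J ⁅ j ⁆) →
    ∀ {m : ℕ} (S : Vec (Subset N) m) → IsLazyOutcome J S →
    (∀ (i : Fin m) → 1# - ε ≤ Cost J (lookup S i)) →
    ∀ (opt : ℕ) → IsOPT J opt →
    fromℕ m ≤ (4 / 3 + fromℕ 3 * ε) * fromℕ opt
theorem3 ℝ ε 0≤ε ε≤3/10 J _ {m} S lazy 1-ε≤Cost opt ((T , T-feasible) , _)
  -- Here `δ` is 3/10 - ε, the slack that parametrizes `Slack`.
  with δ , 0≤δ , ε+δ≈3/10 ← OrderedFieldProperties.≤⇒∃ (RealNumbers.orderedField ℝ) ε≤3/10 =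
  bin-count {m} {opt} (lazy-count J S lazy heavy) (total-weight≤opt J T T-feasible)
  where
  open RealNumbers ℝ hiding (zero)
  open BinPacking ℝ
  open OrderedFieldProperties orderedField
  open BinPackingProperties ℝ
  open Slack 0≤ε 0≤δ ε+δ≈3/10

  heavy : ∀ i → 3-4ε ≤ fromℕ 4 * ∑∈ (lookup S i) (weight J)
  heavy i = ≤-trans (almost-full⇒heavy (1-ε≤Cost i))
    (≤-reflexive (*-congˡ (sym (weight≈M+√B*√B J (lookup S i)))))
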